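{- For every LIiP-model $\mathfrak{M}$, state $s$ of $\mathfrak{M}$ and formula $\phi$: if $\mathfrak{M},s\models\phi$, then there is a finite LIiP-model $\mathfrak{M}_{\mathrm{fin}}$ and a state of $\mathfrak{M}_{\mathrm{fin}}$ at which $\phi$ is true.
   Context: Syntax. Fix a finite set $\mathcal{A}$ of agent names containing a distinguished name $\mathsf{CM}$. Messages: $M ::= a \mid B \mid (M,M)$ with $a\in\mathcal{A}$, $B$ optional application-specific data constants, $(M,M')$ pairs. $\mathcal{P}$ is a denumerable set of propositional variables containing atoms $\mathsf{k}_a(M)$ for all $a\in\mathcal{A}$ and messages $M$. Formulas: $\phi ::= P \mid \phi\wedge\phi \mid \phi\vee\phi \mid \neg\phi \mid \phi\to\phi \mid [M]\phi$. Semantics. An LIiP-model is $(\mathcal{S},\sqsubseteq,\{R_M\}_M,\{D_a\}_{a\in\mathcal{A}},\mathcal{V})$ where $\mathcal{S}$ is a nonempty set of states, $\sqsubseteq$ a partial order on $\mathcal{S}$, $D_a(s)$ a set of messages for each agent $a$ and state $s$, and $\mathrm{cl}_a(s)$ denotes the smallest set of messages containing $a$ and $D_a(s)$ closed under forming pairs of its elements and under taking both components of pairs in it. $\mathcal{V}:\mathcal{P}\to 2^{\mathcal{S}}$ satisfies $\mathcal{V}(\mathsf{k}_a(M))=\{s: M\in\mathrm{cl}_a(s)\}$ and is upward closed along $\sqsubseteq$. Write $M\preceq M'$ iff for all $s$, $M\in\mathrm{cl}_{\mathsf{CM}}(s)$ implies $M'\in\mathrm{cl}_{\mathsf{CM}}(s)$.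 The relations $R_M$ satisfy: (i) $sR_Ms'$ implies $M\in\mathrm{cl}_{\mathsf{CM}}(s')$; (ii) $M\in\mathrm{cl}_{\mathsf{CM}}(s)$ implies $sR_Ms$; (iii) every $s$ has some $s'$ with $sR_Ms'$; (iv) $R_M\subseteq R_{\mathsf{CM}}={\sqsubseteq}$; (v) $sR_{\mathsf{CM}}t$ and $tR_Mu$ imply $sR_Mu$; (vi) $M\preceq M'$ implies $R_M\subseteq R_{M'}$. Satisfaction: atoms via $\mathcal{V}$; $\wedge,\vee$ classically at the state; $s\models\neg\phi$ iff no $s'\sqsupseteq s$ satisfies $\phi$; $s\models\phi\to\psi$ iff every $s'\sqsupseteq s$ satisfying $\phi$ satisfies $\psi$; $s\models[M]\phi$ iff every $s'$ with $sR_Ms'$ satisfies $\phi$. A model is finite if its state set is finite. -}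

module Defs where

open import Data.Fin.Base using (Fin)
open import Data.Nat.Base using (ℕ)
open import Data.Product.Base using (∃; _×_)
open import Data.Sum.Base using (_⊎_)
open import Function.Bundles using (_↔_; _⇔_)
open import Level using (Level; suc)
open import Relation.Binary.Core using (Rel; _⇒_)
open import Relation.Binary.Structures using (IsPartialOrder)
open import Relation.Binary.PropositionalEquality.Core using (_≡_)
open import Relation.Nullary.Negation.Core using (¬_)
open import Relation.Unary using (Pred; _∈_)

private
  variable
    ℓ : Level

Finite : Set ℓ → Set ℓ
Finite A = ∃ λ n → A ↔ Fin n

Denumerable : Set ℓ → Set ℓ
Denumerable A = A ↔ ℕ

infixr 4 ⟪_,_⟫

data Message (Agent Datum : Set) : Set where
  name   : Agent → Message Agent Datum
  datum  : Datum → Message Agent Datum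
  ⟪_,_⟫ : (M M′ : Message Agent Datum) → Message Agent Datum

-- The propositional variables are the atoms k a M together with arbitrary
-- further ones, indexed by Other.
data PropVar (Agent Datum Other : Set) : Set where
  k     : Agent → Message Agent Datum → PropVar Agent Datum Other
  other : Other → PropVar Agent Datum Other

-- Datum and Other may be empty.
record Language : Set₁ where
  field
    Agent       : Set
    finite      : Finite Agent
    CM          : Agent
    Datum       : Set
    Other       : Set
    denumerable : Denumerable (PropVar Agent Datum Other)

  Msg : Set
  Msg = Message Agent Datum

  𝒫 : Set
  𝒫 = PropVar Agent Datum Other

module _ (L : Language) where

  open Language L

  infixr 8 _`∧_
  infixr 7 _`∨_
  infixr 6 _`→_
  infix  9 `¬_ [_]_

  data Formula : Set where
    var  : 𝒫 → Formula
    _`∧_ : Formula → Formula → Formula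
    _`∨_ : Formula → Formula → Formula
    `¬_  : Formula → Formula
    _`→_ : Formula → Formula → Formula
    [_]_ : Msg → Formula → Formula

  data Closure (a : Agent) (D : Pred Msg ℓ) : Pred Msg ℓ where
    self : name a ∈ Closure a D
    base : ∀ {M} → M ∈ D → M ∈ Closure a D
    pair : ∀ {M M′} → M ∈ Closure a D → M′ ∈ Closure a D → ⟪ M , M′ ⟫ ∈ Closure a D
    fst  : ∀ {M M′} → ⟪ M , M′ ⟫ ∈ Closure a D → M ∈ Closure a D
    snd  : ∀ {M M′} → ⟪ M , M′ ⟫ ∈ Closure a D → M′ ∈ Closure a D

  record Model (ℓ : Level) : Set (suc ℓ) where
    infix 4 _⊑_ _≼_
    field
      State          : Set ℓ
      inhabitant     : State
      _⊑_            : Rel State ℓ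
      isPartialOrder : IsPartialOrder _≡_ _⊑_
      R              : Msg → Rel State ℓ
      D              : Agent → State → Pred Msg ℓ
      𝒱              : 𝒫 → Pred State ℓ

    cl : Agent → State → Pred Msg ℓ
    cl a s = Closure a (D a s)

    _≼_ : Msg → Msg → Set ℓ
    M ≼ M′ = ∀ s → M ∈ cl CM s → M′ ∈ cl CM s

    field
      𝒱-k       : ∀ a M s → s ∈ 𝒱 (k a M) ⇔ M ∈ cl a s
      𝒱-upward  : ∀ P {s t} → s ⊑ t → s ∈ 𝒱 P → t ∈ 𝒱 P
      R-knows   : ∀ M {s s′} → R M s s′ → M ∈ cl CM s′
      R-refl    : ∀ M {s} → M ∈ cl CM s → R M s s
      R-serial  : ∀ M s → ∃ λ s′ → R M s s′
      R⊆R-CM    : ∀ M → R M ⇒ R (name CM)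
      R-CM⇔⊑    : ∀ s t → R (name CM) s t ⇔ s ⊑ t
      R-trans   : ∀ M {s t u} → R (name CM) s t → R M t u → R M s u
      R-mono    : ∀ M M′ → M ≼ M′ → R M ⇒ R M′

FiniteModel : {L : Language} → Model L ℓ → Set ℓ
FiniteModel 𝔐 = Finite (Model.State 𝔐)

infix 4 _,_⊨_

_,_⊨_ : {L : Language} (𝔐 : Model L ℓ) → Model.State 𝔐 → Formula L → Set ℓ
𝔐 , s ⊨ var P   = s ∈ Model.𝒱 𝔐 P
𝔐 , s ⊨ φ `∧ ψ  = 𝔐 , s ⊨ φ × 𝔐 , s ⊨ ψ
𝔐 , s ⊨ φ `∨ ψ  = 𝔐 , s ⊨ φ ⊎ 𝔐 , s ⊨ ψ
𝔐 , s ⊨ `¬ φ    = ∀ s′ → Model._⊑_ 𝔐 s s′ → ¬ (𝔐 , s′ ⊨ φ)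
𝔐 , s ⊨ φ `→ ψ  = ∀ s′ → Model._⊑_ 𝔐 s s′ → 𝔐 , s′ ⊨ φ → 𝔐 , s′ ⊨ ψ
𝔐 , s ⊨ [ M ] φ = ∀ s′ → Model.R 𝔐 M s s′ → 𝔐 , s′ ⊨ φ

{-# OPTIONS --safe #-}
-- Every state t lies below a state that decides each of the finitely many
-- atoms of φ.  Above such a state no formula built from these atoms changes its
-- truth value, so seriality makes [ M ] ψ equivalent to ψ and every k CM M
-- true; hence φ holds in a model with one state at which CM knows every
-- message.  Constructively a deciding state exists only up to double negation,
-- but only finitely many one-state models have to be tried, so the double
-- negation can be removed.
module Submission where

open import Defs
open import Data.Fin.Base using (Fin; zero; suc)
open import Data.Fin.Properties using (1↔⊤; any?) renaming (_≟_ to _≟ᶠ_)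
open import Data.Fin.Subset using (Subset; inside; outside) renaming (_∈_ to _∈ˢ_)
open import Data.Fin.Subset.Properties using (_∈?_; anySubset?; drop-there)
open import Data.List.Base using (List; [_]; _++_; length; lookup)
open import Data.List.Membership.Propositional using () renaming (_∈_ to _∈ˡ_)
open import Data.List.Membership.Propositional.Properties using (∈-++⁺ˡ; ∈-++⁺ʳ)
open import Data.List.Relation.Unary.Any using (here; index)
open import Data.List.Relation.Unary.Any.Properties using (lookup-index)
open import Data.Nat.Base using (zero; suc)
open import Data.Nat.Properties using () renaming (_≟_ to _≟ℕ_)
open import Data.Product.Base using (Σ-syntax; ∃-syntax; _×_; _,_; proj₁; proj₂)
open import Data.Sum.Base using (_⊎_; inj₁; inj₂)
import Data.Sum.Base as Sum
open import Data.Unit.Base using (⊤; tt)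
open import Data.Unit.Properties using (≡-isPartialOrder)
open import Data.Vec.Base using ([]; _∷_; here; there)
open import Function.Base using (_∘_; id)
open import Function.Bundles using (mk⇔; Equivalence)
open import Function.Properties.Inverse using (↔-sym; ↔⇒↣)
open import Level using (Level; 0ℓ)
open import Relation.Binary.Definitions using (DecidableEquality)
open import Relation.Binary.PropositionalEquality using (_≡_; refl; sym; subst)
open import Relation.Binary.Structures using (IsPartialOrder)
open import Relation.Nullary.Decidable
  using (Dec; yes; no; map′; ¬?; _×-dec_; _⊎-dec_; _→-dec_; via-injection; decidable-stable; ¬¬-excluded-middle)
open import Relation.Nullary.Negation using (¬_; contradiction)
open import Relation.Unary using (Pred; _∈_; _⊆_; Decidable)

module _ (L : Language) where

  open Language L

  _≟ᴬ_ : DecidableEquality Agent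
  _≟ᴬ_ = via-injection (↔⇒↣ (proj₂ finite)) _≟ᶠ_

  _≟ᴾ_ : DecidableEquality 𝒫
  _≟ᴾ_ = via-injection (↔⇒↣ denumerable) _≟ℕ_

  -- The truth value of k a ⟪ M , M′ ⟫ is determined by those of k a M and k a M′.
  primes : 𝒫 → List 𝒫
  primes (k a ⟪ M , M′ ⟫) = primes (k a M) ++ primes (k a M′)
  primes P                = [ P ]

  atoms : Formula L → List 𝒫
  atoms (var P)   = primes P
  atoms (φ `∧ ψ)  = atoms φ ++ atoms ψ
  atoms (φ `∨ ψ)  = atoms φ ++ atoms ψ
  atoms (`¬ φ)    = atoms φ
  atoms (φ `→ ψ)  = atoms φ ++ atoms ψ
  atoms ([ M ] φ) = atoms φ

  module OneState (ρ : Pred 𝒫 0ℓ) where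

    -- Recursion on the message, instead of a `Closure` over `ρ`, keeps knowledge decidable and
    -- already closed under pairing and projection. The disjunct `a ≡ CM` serves `R-knows`, and
    -- `a ≡ b` puts each agent's own name in.
    Knows : Agent → Pred Msg 0ℓ
    Knows a (name b)     = a ≡ CM ⊎ a ≡ b ⊎ ρ (k a (name b))
    Knows a (datum d)    = a ≡ CM ⊎ ρ (k a (datum d))
    Knows a ⟪ M , M′ ⟫ = Knows a M × Knows a M′

    Holds : Pred 𝒫 0ℓ
    Holds (k a M)   = Knows a M
    Holds (other o) = ρ (other o)

    CM-knows : ∀ M → M ∈ Knows CM
    CM-knows (name b)     = inj₁ refl
    CM-knows (datum d)    = inj₁ refl
    CM-knows ⟪ M , M′ ⟫ = CM-knows M , CM-knows M′

    closure⊆knows : ∀ {a} → Closure L a (Knows a) ⊆ Knows a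
    closure⊆knows self       = inj₂ (inj₁ refl)
    closure⊆knows (base x)   = x
    closure⊆knows (pair x y) = closure⊆knows x , closure⊆knows y
    closure⊆knows (fst x)    = proj₁ (closure⊆knows x)
    closure⊆knows (snd x)    = proj₂ (closure⊆knows x)

    model : Model L 0ℓ
    model = record
      { State          = ⊤
      ; inhabitant     = tt
      ; _⊑_            = _≡_
      ; isPartialOrder = ≡-isPartialOrder
      -- Seriality leaves no other choice on a single state, and it forces `CM` to know every
      -- message.
      ; R              = λ _ → _≡_
      ; D              = λ a _ → Knows a
      ; 𝒱              = λ P _ → Holds P
      ; 𝒱-k            = λ a M s → mk⇔ base closure⊆knows
      ; 𝒱-upward       = λ _ _ → id
      ; R-knows        = λ M _ → base (CM-knows M)
      ; R-refl         = λ _ _ → refl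
      ; R-serial       = λ _ s → s , refl
      ; R⊆R-CM         = λ _ → id
      ; R-CM⇔⊑         = λ _ _ → mk⇔ id id
      ; R-trans        = λ _ _ _ → refl
      ; R-mono         = λ _ _ _ → id
      }

    module _ (ρ? : Decidable ρ) where

      knows? : ∀ a → Decidable (Knows a)
      knows? a (name b)     = (a ≟ᴬ CM) ⊎-dec (a ≟ᴬ b) ⊎-dec ρ? _
      knows? a (datum d)    = (a ≟ᴬ CM) ⊎-dec ρ? _
      knows? a ⟪ M , M′ ⟫ = knows? a M ×-dec knows? a M′

      model⊨? : ∀ φ → Dec (model , tt ⊨ φ)
      model⊨? (var (k a M))   = knows? a M
      model⊨? (var (other o)) = ρ? _
      model⊨? (φ `∧ ψ)        = model⊨? φ ×-dec model⊨? ψ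
      model⊨? (φ `∨ ψ)        = model⊨? φ ⊎-dec model⊨? ψ
      model⊨? (`¬ φ)          = map′ (λ f _ _ → f) (λ f → f tt refl) (¬? (model⊨? φ))
      model⊨? (φ `→ ψ)        = map′ (λ f _ _ → f) (λ f → f tt refl) (model⊨? φ →-dec model⊨? ψ)
      model⊨? ([ M ] φ)       = map′ (λ f _ _ → f) (λ f → f tt refl) (model⊨? φ)

  module _ {ℓ : Level} (𝔐 : Model L ℓ) where

    open Model 𝔐
    open IsPartialOrder isPartialOrder using () renaming (refl to ⊑-refl; trans to ⊑-trans)

    R⇒⊑ : ∀ M {s t} → R M s t → s ⊑ t
    R⇒⊑ M r = Equivalence.to (R-CM⇔⊑ _ _) (R⊆R-CM M r)

    ⊨-upward : ∀ φ {s t} → s ⊑ t → 𝔐 , s ⊨ φ → 𝔐 , t ⊨ φ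
    ⊨-upward (var P)   s⊑t x        = 𝒱-upward P s⊑t x
    ⊨-upward (φ `∧ ψ)  s⊑t (x , y)  = ⊨-upward φ s⊑t x , ⊨-upward ψ s⊑t y
    ⊨-upward (φ `∨ ψ)  s⊑t (inj₁ x) = inj₁ (⊨-upward φ s⊑t x)
    ⊨-upward (φ `∨ ψ)  s⊑t (inj₂ y) = inj₂ (⊨-upward ψ s⊑t y)
    ⊨-upward (`¬ φ)    s⊑t f u t⊑u  = f u (⊑-trans s⊑t t⊑u)
    ⊨-upward (φ `→ ψ)  s⊑t f u t⊑u  = f u (⊑-trans s⊑t t⊑u)
    ⊨-upward ([ M ] φ) s⊑t f u r    = f u (R-trans M (Equivalence.from (R-CM⇔⊑ _ _) s⊑t) r)

    -- For upward closed U: membership in U is equivalent to A throughout the cone above s.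
    Settled : ∀ {a} → State → Pred State ℓ → Set a → Set _
    Settled s U A = (A → s ∈ U) × (∀ t → s ⊑ t → t ∈ U → A)

    settled-upward : ∀ {a} {A : Set a} P {s t} → s ⊑ t → Settled s (𝒱 P) A → Settled t (𝒱 P) A
    settled-upward P s⊑t (f , g) = 𝒱-upward P s⊑t ∘ f , λ u t⊑u → g u (⊑-trans s⊑t t⊑u)

    -- Atoms are decided one at a time. After the others are settled at `t`, either the first atom
    -- holds somewhere above `t`, and moving there makes it true for good, or it is false on the
    -- whole cone. Moving up preserves the earlier decisions.
    settle : ∀ {n} (P : Fin n → 𝒫) s →
      ¬ ¬ (∃[ t ] s ⊑ t × ∃[ p ] (∀ i → Settled t (𝒱 (P i)) (i ∈ˢ p)))
    settle {zero}  P s ¬settled = ¬settled (s , ⊑-refl , [] , λ ())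
    settle {suc n} P s ¬settled = settle (P ∘ suc) s λ (t , s⊑t , p , tail) →
      ¬¬-excluded-middle {A = ∃[ u ] t ⊑ u × u ∈ 𝒱 (P zero)} λ where
        (yes (u , t⊑u , x)) → ¬settled (u , ⊑-trans s⊑t t⊑u , inside ∷ p , λ where
          zero    → (λ _ → x) , λ _ _ _ → here
          (suc i) → extend (settled-upward (P (suc i)) t⊑u (tail i)))
        (no ¬above) → ¬settled (t , s⊑t , outside ∷ p , λ where
          zero    → (λ ()) , λ u t⊑u x → contradiction (u , t⊑u , x) ¬above
          (suc i) → extend (tail i))
      where
      extend : ∀ {b t i p} → Settled t (𝒱 (P (suc i))) (i ∈ˢ p) →
        Settled t (𝒱 (P (suc i))) (suc i ∈ˢ (b ∷ p))
      extend (f , g) = f ∘ drop-there , λ u t⊑u x → there (g u t⊑u x)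

    module _ (ρ : Pred 𝒫 0ℓ) (s : State) where

      open OneState ρ

      AllSettled : List 𝒫 → Set _
      AllSettled Ps = ∀ {P} → P ∈ˡ Ps → Settled s (𝒱 P) (ρ P)

      -- `CM` knows `M` at any `R M`-successor of `s`. One exists by seriality and lies above `s`,
      -- so settledness carries the knowledge back down to `s`.
      CM-settled : ∀ {M} → Settled s (𝒱 (k CM M)) (ρ (k CM M)) → s ∈ 𝒱 (k CM M)
      CM-settled {M} (f , g) with R-serial M s
      ... | t , r = f (g t (R⇒⊑ M r) (Equivalence.from (𝒱-k CM M t) (R-knows M r)))

      -- `Holds` goes beyond `ρ` on names and data only for `CM` and for an agent's own name, and
      -- there `𝔐` makes the atom true at `s` as well.
      holds-settled : ∀ P → AllSettled (primes P) → Settled s (𝒱 P) (Holds P)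
      holds-settled (k a (name b)) σ = to , λ t s⊑t x → inj₂ (inj₂ (proj₂ (σ (here refl)) t s⊑t x))
        where
        to : Knows a (name b) → s ∈ 𝒱 (k a (name b))
        to (inj₁ refl)        = CM-settled (σ (here refl))
        to (inj₂ (inj₁ refl)) = Equivalence.from (𝒱-k a (name a) s) self
        to (inj₂ (inj₂ x))    = proj₁ (σ (here refl)) x
      holds-settled (k a (datum d)) σ = to , λ t s⊑t x → inj₂ (proj₂ (σ (here refl)) t s⊑t x)
        where
        to : Knows a (datum d) → s ∈ 𝒱 (k a (datum d))
        to (inj₁ refl) = CM-settled (σ (here refl))
        to (inj₂ x)    = proj₁ (σ (here refl)) x
      holds-settled (k a ⟪ M , M′ ⟫) σ
        with holds-settled (k a M) (σ ∘ ∈-++⁺ˡ)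
           | holds-settled (k a M′) (σ ∘ ∈-++⁺ʳ (primes (k a M)))
      ... | f , g | f′ , g′ =
        (λ (x , y) → from s (pair (to s (f x)) (to s (f′ y)))) ,
        λ t s⊑t x → g t s⊑t (from t (fst (to t x))) , g′ t s⊑t (from t (snd (to t x)))
        where
        to : ∀ {M} t → t ∈ 𝒱 (k a M) → M ∈ cl a t
        to t = Equivalence.to (𝒱-k a _ t)
        from : ∀ {M} t → M ∈ cl a t → t ∈ 𝒱 (k a M)
        from t = Equivalence.from (𝒱-k a _ t)
      holds-settled (other o) σ = σ (here refl)

      -- Truth is constant on the cone above `s`, so quantifying over that cone collapses to the
      -- single point. The two halves are proved together because negation and implication exchange
      -- them.
      ⊨-settled : ∀ φ → AllSettled (atoms φ) → Settled s (λ t → 𝔐 , t ⊨ φ) (model , tt ⊨ φ)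
      ⊨-settled (var P) σ = holds-settled P σ
      ⊨-settled (φ `∧ ψ) σ
        with ⊨-settled φ (σ ∘ ∈-++⁺ˡ) | ⊨-settled ψ (σ ∘ ∈-++⁺ʳ (atoms φ))
      ... | f , g | f′ , g′ =
        (λ (x , y) → f x , f′ y) ,
        λ t s⊑t (x , y) → g t s⊑t x , g′ t s⊑t y
      ⊨-settled (φ `∨ ψ) σ
        with ⊨-settled φ (σ ∘ ∈-++⁺ˡ) | ⊨-settled ψ (σ ∘ ∈-++⁺ʳ (atoms φ))
      ... | f , g | f′ , g′ =
        Sum.map f f′ ,
        λ t s⊑t → Sum.map (g t s⊑t) (g′ t s⊑t)
      ⊨-settled (`¬ φ) σ with ⊨-settled φ σ
      ... | f , g =
        (λ h t s⊑t x → h tt refl (g t s⊑t x)) ,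
        λ t s⊑t h _ _ x → h t ⊑-refl (⊨-upward φ s⊑t (f x))
      ⊨-settled (φ `→ ψ) σ
        with ⊨-settled φ (σ ∘ ∈-++⁺ˡ) | ⊨-settled ψ (σ ∘ ∈-++⁺ʳ (atoms φ))
      ... | f , g | f′ , g′ =
        (λ h t s⊑t x → ⊨-upward ψ s⊑t (f′ (h tt refl (g t s⊑t x)))) ,
        λ t s⊑t h _ _ x → g′ t s⊑t (h t ⊑-refl (⊨-upward φ s⊑t (f x)))
      ⊨-settled ([ M ] φ) σ with ⊨-settled φ σ
      ... | f , g =
        (λ h t r → ⊨-upward φ (R⇒⊑ M r) (f (h tt refl))) ,
        -- Seriality guards against a vacuous box: some successor `u` of `t` satisfies `φ`, and `u`
        -- still lies above `s`.
        λ t s⊑t h _ _ → let u , r = R-serial M t in g u (⊑-trans s⊑t (R⇒⊑ M r)) (h u r)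

  -- A valuation is coded by a set of list positions, so that there are finitely many candidates,
  -- each decidable and independent of the level of `𝔐`.
  Selected : ∀ Ps → Subset (length Ps) → Pred 𝒫 0ℓ
  Selected Ps p P = ∃[ i ] i ∈ˢ p × lookup Ps i ≡ P

  selected? : ∀ Ps p → Decidable (Selected Ps p)
  selected? Ps p P = any? λ i → (i ∈? p) ×-dec (_ ≟ᴾ P)

theorem4 : ∀ {ℓ : Level} (L : Language) (𝔐 : Model L ℓ) (s : Model.State 𝔐) (φ : Formula L) →
    𝔐 , s ⊨ φ →
    Σ[ 𝔐fin ∈ Model L 0ℓ ] (FiniteModel 𝔐fin × (∃[ t ] (𝔐fin , t ⊨ φ)))
theorem4 L 𝔐 s φ s⊨φ = model (ρ p) , (1 , ↔-sym 1↔⊤) , tt , p⊨φ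
  where
  open OneState L
  open Model 𝔐

  Ps = atoms L φ

  ρ : Subset (length Ps) → Pred (Language.𝒫 L) 0ℓ
  ρ = Selected L Ps

  -- An atom may occur at several positions; these cannot disagree, since each records the truth of
  -- the same atom at `t`.
  all-settled : ∀ {t p} → (∀ i → Settled L 𝔐 t (𝒱 (lookup Ps i)) (i ∈ˢ p)) →
    AllSettled L 𝔐 (ρ p) t Ps
  all-settled {t} σ P∈ =
    (λ { (i , i∈p , refl) → proj₁ (σ i) i∈p }) ,
    λ u t⊑u x → index P∈ ,
      proj₂ (σ (index P∈)) u t⊑u (subst (λ P → u ∈ 𝒱 P) (lookup-index P∈) x) ,
      sym (lookup-index P∈)

  satisfying : ∃[ p ] (model (ρ p) , tt ⊨ φ)
  satisfying = decidable-stable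
    (anySubset? λ p → model⊨? (ρ p) (selected? L Ps p) φ)
    -- If every subset failed, the one obtained at a settled state above `s` would be a
    -- counterexample: `φ` persists to that state and transfers to its one-state model.
    λ unsat → settle L 𝔐 (lookup Ps) s λ (t , s⊑t , p , σ) →
      unsat (p , proj₂ (⊨-settled L 𝔐 (ρ p) t φ (all-settled σ)) t
        (IsPartialOrder.refl isPartialOrder) (⊨-upward L 𝔐 φ s⊑t s⊨φ))

  p   = proj₁ satisfying
  p⊨φ = proj₂ satisfying
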